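{- Let $\mathcal{G}$ be a finite weighted coloured--edge graph with $n\ge 2$ vertices and $k$ colours, and let $u\ne v$ be vertices. Then any set $S$ of minimal paths from $u$ to $v$ that are pairwise incomparable has $|S|\le k^{n-1}$. Equivalently, the set of distinct weight vectors $(\omega_c(p))_{c\in M}$ of minimal paths $p$ from $u$ to $v$ has at most $k^{n-1}$ elements.
   Context: A weighted coloured--edge graph $\mathcal{G}=\langle V,E,\omega,\lambda\rangle$ consists of a directed multigraph with vertex set $V$ and edge set $E$ (each edge $e$ has an initial vertex and a distinct terminal vertex; multiple edges between the same ordered pair are allowed), a weight function $\omega:E\to\mathbb{R}^+$ (strictly positive reals), and a surjective colour function $\lambda:E\to M$ onto a set $M$ of colours; $k=|M|$. A path from $u$ to $v$ is a sequence of edges $e_1,\dots,e_l$ ($l\ge1$) such that the initial vertex of $e_1$ is $u$, the terminal vertex of $e_l$ is $v$, the terminal vertex of $e_i$ is the initial vertex of $e_{i+1}$, and no vertex is visited twice. For a path $p$ and colour $c$, $\omega_c(p)$ is the sum of $\omega(e)$ over edges $e$ of $p$ with $\lambda(e)=c$. For paths $p,q$ from $u$ to $v$, $p\le q$ means $\omega_c(p)\le\omega_c(q)$ for all $c\in M$; $p,q$ are incomparable if neither $p\le q$ nor $q\le p$. A path $p$ from $u$ to $v$ is minimal if there is no path $q$ from $u$ to $v$ with $q\le p$ and $\omega_c(q)<\omega_c(p)$ for some colour $c$. -}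

module Defs where

open import Data.Nat.Base as ℕ using (ℕ)
import Data.Nat.Properties as ℕ
open import Data.Fin.Base using (Fin)
open import Data.Fin.Properties using (_≟_)
open import Data.List.Base using (List; []; _∷_; foldr; map; filter)
open import Data.List.Relation.Unary.Unique.Propositional using (Unique)
open import Data.Product.Base using (∃; ∃-syntax; _×_; _,_)
open import Data.Rational.Base as ℚ using (ℚ; 0ℚ; ½; ∣_∣)
import Data.Rational.Properties as ℚ
open import Data.Rational.Solver using (module +-*-Solver)
open import Function.Definitions using (Surjective)
open import Relation.Binary.PropositionalEquality
  using (_≡_; _≢_; refl; sym; trans; cong; subst)
open import Relation.Nullary.Negation.Core using (¬_)

IsCauchy : (ℕ → ℚ) → Set
IsCauchy x = ∀ ε → 0ℚ ℚ.< ε →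
  ∃[ N ] ∀ m n → N ℕ.≤ m → N ℕ.≤ n → ∣ x m ℚ.- x n ∣ ℚ.< ε

-- Real numbers as Cauchy sequences of rationals; equality of reals is the
-- setoid equality _≃_ below, not _≡_.
record ℝ : Set where
  constructor mkℝ
  field
    seq    : ℕ → ℚ
    cauchy : IsCauchy seq

open ℝ public

infix 4 _≃_ _<_ _≤_
infixl 6 _+_

_≃_ : ℝ → ℝ → Set
x ≃ y = ∀ ε → 0ℚ ℚ.< ε →
  ∃[ N ] ∀ n → N ℕ.≤ n → ∣ seq x n ℚ.- seq y n ∣ ℚ.< ε

_<_ : ℝ → ℝ → Set
x < y = ∃[ ε ] 0ℚ ℚ.< ε × ∃[ N ] ∀ n → N ℕ.≤ n → seq x n ℚ.+ ε ℚ.≤ seq y n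

_≤_ : ℝ → ℝ → Set
x ≤ y = ¬ (y < x)

0ℝ : ℝ
0ℝ = mkℝ (λ _ → 0ℚ) (λ _ 0<ε → 0 , λ _ _ _ _ → 0<ε)

halves : ∀ ε → ½ ℚ.* ε ℚ.+ ½ ℚ.* ε ≡ ε
halves ε = trans (sym (ℚ.*-distribʳ-+ ε ½ ½)) (ℚ.*-identityˡ ε)

0<½* : ∀ {ε} → 0ℚ ℚ.< ε → 0ℚ ℚ.< ½ ℚ.* ε
0<½* {ε} 0<ε = subst (ℚ._< ½ ℚ.* ε) (ℚ.*-zeroʳ ½) (ℚ.*-monoʳ-<-pos ½ 0<ε)

interchange : ∀ a b c d →
  (a ℚ.+ b) ℚ.- (c ℚ.+ d) ≡ (a ℚ.- c) ℚ.+ (b ℚ.- d)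
interchange = solve 4
  (λ a b c d → (a :+ b) :- (c :+ d) := (a :- c) :+ (b :- d)) refl
  where open +-*-Solver

+-cauchy : ∀ x y → IsCauchy x → IsCauchy y → IsCauchy (λ n → x n ℚ.+ y n)
+-cauchy x y cx cy ε 0<ε
  with cx (½ ℚ.* ε) (0<½* 0<ε) | cy (½ ℚ.* ε) (0<½* 0<ε)
... | N₁ , close₁ | N₂ , close₂ = N₁ ℕ.⊔ N₂ , λ m n N≤m N≤n → begin-strict
  ∣ (x m ℚ.+ y m) ℚ.- (x n ℚ.+ y n) ∣
    ≡⟨ cong ∣_∣ (interchange (x m) (y m) (x n) (y n)) ⟩
  ∣ (x m ℚ.- x n) ℚ.+ (y m ℚ.- y n) ∣
    ≤⟨ ℚ.∣p+q∣≤∣p∣+∣q∣ (x m ℚ.- x n) (y m ℚ.- y n) ⟩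
  ∣ x m ℚ.- x n ∣ ℚ.+ ∣ y m ℚ.- y n ∣
    <⟨ ℚ.+-mono-<
         (close₁ m n (ℕ.m⊔n≤o⇒m≤o N₁ N₂ N≤m) (ℕ.m⊔n≤o⇒m≤o N₁ N₂ N≤n))
         (close₂ m n (ℕ.m⊔n≤o⇒n≤o N₁ N₂ N≤m) (ℕ.m⊔n≤o⇒n≤o N₁ N₂ N≤n)) ⟩
  ½ ℚ.* ε ℚ.+ ½ ℚ.* ε
    ≡⟨ halves ε ⟩
  ε ∎
  where open ℚ.≤-Reasoning

_+_ : ℝ → ℝ → ℝ
x + y = mkℝ (λ n → seq x n ℚ.+ seq y n) (+-cauchy (seq x) (seq y) (cauchy x) (cauchy y))

-- Vertices are Fin n and colours are Fin k. Edges are named, so several edges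
-- may share their endpoints.
record WeightedColouredGraph (n k : ℕ) : Set where
  field
    size        : ℕ
    source      : Fin size → Fin n
    target      : Fin size → Fin n
    loopless    : ∀ e → source e ≢ target e
    weight      : Fin size → ℝ
    weight-pos  : ∀ e → 0ℝ < weight e
    colour      : Fin size → Fin k
    colour-onto : Surjective _≡_ _≡_ colour

module Paths {n k : ℕ} (G : WeightedColouredGraph n k) where
  open WeightedColouredGraph G

  data IsWalk : Fin n → List (Fin size) → Fin n → Set where
    last : ∀ {u v e} → source e ≡ u → target e ≡ v → IsWalk u (e ∷ []) v
    step : ∀ {u v e es} → source e ≡ u → IsWalk (target e) es v →
           IsWalk u (e ∷ es) v

  record Path (u v : Fin n) : Set where
    field
      edges  : List (Fin size)
      isWalk : IsWalk u edges v
      simple : Unique (u ∷ map target edges)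

  open Path public

  pathWeight : ∀ {u v} → Path u v → Fin k → ℝ
  pathWeight p c =
    foldr _+_ 0ℝ (map weight (filter (λ e → colour e ≟ c) (edges p)))

  infix 4 _≼_

  _≼_ : ∀ {u v} → Path u v → Path u v → Set
  p ≼ q = ∀ c → pathWeight p c ≤ pathWeight q c

  Incomparable : ∀ {u v} → Path u v → Path u v → Set
  Incomparable p q = ¬ (p ≼ q) × ¬ (q ≼ p)

  Minimal : ∀ {u v} → Path u v → Set
  Minimal {u} {v} p =
    ¬ (∃[ q ] q ≼ p × ∃[ c ] pathWeight q c < pathWeight p c)

  infix 4 _≋_

  _≋_ : (Fin k → ℝ) → (Fin k → ℝ) → Set
  x ≋ y = ∀ c → x c ≃ y c

  IsMinimalWeight : Fin n → Fin n → (Fin k → ℝ) → Set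
  IsMinimalWeight u v x = ∃ λ (p : Path u v) → Minimal p × x ≋ pathWeight p

{-# OPTIONS --safe #-}
module Submission where

-- Repeatedly merge a vertex into u. Split the minimal paths by the colour c of
-- their first edge; let e be a c-coloured edge out of u, to y say, of least
-- weight among those used. A path starting with colour c and passing through y
-- can be rerouted to reach y by e, so by minimality its weight is unchanged. If
-- y = v, then all these paths have the weight of e. Otherwise merge y into u:
-- the new first edges are the edges out of y and the old c-coloured edges, each
-- of the latter paying its excess over e. This is the same situation with one
-- vertex less, so k classes at each of n - 1 steps give the bound k^(n-1).
--
-- Instead of subtracting the weight of e, the paths to the merged vertices are
-- kept and only compared with each other: two of them in the class c agree in
-- all other colours. Thus the argument needs no cancellation and works in any
-- ordered monoid.

open import Defs
open import Algebra.Structures using (IsMonoid)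
open import Data.Nat.Base using (ℕ; _∸_; _^_) renaming (_≤_ to _≤ℕ_)
import Data.Nat.Base as ℕ
import Data.Nat.Properties as ℕ
open import Data.Fin.Base using (Fin; zero; suc)
open import Data.Fin.Properties using (_≟_; nonZeroIndex)
open import Data.Fin.Subset using (Subset; _∈_; _∉_; _⊆_; _-_; ⊤) renaming (∣_∣ to card)
open import Data.Fin.Subset.Properties
  using (∈⊤; ∣⊤∣≡n; p─q⊆p; x∈p∧x≢y⇒x∈p-y; p─x─y≡p─y─x; x∈p⇒∣p-x∣<∣p∣)
open import Data.List.Base using (List; []; _∷_; _++_; foldr; map; filter; length)
open import Data.List.Properties
  using (++-assoc; length-map; filter-++; filter-reject)
open import Data.List.Relation.Binary.Sublist.Propositional using ([]; _∷_; _∷ʳ_)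
  renaming (_⊆_ to _⊆ˡ_)
open import Data.List.Relation.Binary.Sublist.Propositional.Properties
  using (All-resp-⊆)
open import Data.List.Relation.Unary.All as All using (All; []; _∷_)
import Data.List.Relation.Unary.All.Properties as All
open import Data.List.Relation.Unary.AllPairs as AllPairs using (AllPairs; []; _∷_)
import Data.List.Relation.Unary.AllPairs.Properties as AllPairs
open import Data.List.Relation.Unary.Unique.Propositional using (Unique)
open import Data.Product.Base using (∃₂; ∃-syntax; _×_; _,_)
open import Data.Rational.Base as ℚ using (ℚ; 0ℚ; ½; ∣_∣)
import Data.Rational.Properties as ℚ
open import Data.Rational.Solver using (module +-*-Solver)
open import Data.Sum.Base using (_⊎_; inj₁; inj₂)
open import Data.Vec.Base using (there) renaming (_∷_ to _∷ᵛ_)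
open import Function.Base using (_∘_; id)
open import Level using (0ℓ)
open import Relation.Binary.Bundles using (Poset)
import Relation.Binary.Reasoning.PartialOrder as PosetReasoning
open import Relation.Binary.Structures using (IsEquivalence; IsPartialOrder)
open import Relation.Binary.PropositionalEquality
  using (_≡_; _≢_; refl; sym; trans; cong; subst; ≢-sym)
open import Relation.Nullary.Decidable.Core using (Dec; yes; no; decidable-stable)
open import Relation.Nullary.Negation.Core using (¬_; contradiction)

-- The order of the reals is total only up to double negation, which suffices
-- because a bound on the length of a list is decidable.
record OrderedMonoid : Set₁ where
  infix  4 _≈_ _⊑_
  infixl 6 _∙_
  field
    {Carrier}      : Set
    {_≈_ _⊑_}      : Carrier → Carrier → Set
    {_∙_}          : Carrier → Carrier → Carrier
    {ε}            : Carrier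
    isMonoid       : IsMonoid _≈_ _∙_ ε
    isPartialOrder : IsPartialOrder _≈_ _⊑_
    ∙-mono         : ∀ {x y x′ y′} → x ⊑ y → x′ ⊑ y′ → x ∙ x′ ⊑ y ∙ y′
    ¬¬-total       : ∀ x y → ¬ ¬ (x ⊑ y ⊎ y ⊑ x)

  open IsMonoid isMonoid public
    using (identityˡ; identityʳ; assoc; ∙-congˡ)
    renaming (refl to ≈-refl; sym to ≈-sym; trans to ≈-trans)
  open IsPartialOrder isPartialOrder public
    using ()
    renaming (refl to ⊑-refl; trans to ⊑-trans; antisym to ⊑-antisym; reflexive to ⊑-reflexive)

  poset : Poset 0ℓ 0ℓ 0ℓ
  poset = record { isPartialOrder = isPartialOrder }

-- Lists and finite sets

AllPairs-resp-⊆ : ∀ {A : Set} {R : A → A → Set} {xs ys : List A} →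
  xs ⊆ˡ ys → AllPairs R ys → AllPairs R xs
AllPairs-resp-⊆ []         []       = []
AllPairs-resp-⊆ (_ ∷ʳ s)   (_ ∷ rs) = AllPairs-resp-⊆ s rs
AllPairs-resp-⊆ (refl ∷ s) (r ∷ rs) = All-resp-⊆ s r ∷ AllPairs-resp-⊆ s rs

-- Each element goes to the side that its own proof selects, so neither property has to be
-- decidable. The parts are sublists so that pairwise conditions restrict to them.
⊆-split : ∀ {A : Set} {P Q : A → Set} {xs : List A} → All (λ x → P x ⊎ Q x) xs →
  ∃₂ λ ys zs → ys ⊆ˡ xs × zs ⊆ˡ xs × All P ys × All Q zs ×
    length xs ≡ length ys ℕ.+ length zs
⊆-split [] = [] , [] , [] , [] , [] , [] , refl
⊆-split (inj₁ p ∷ ps) =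
  let ys , zs , ys⊆ , zs⊆ , pys , qzs , eq = ⊆-split ps
  in _ ∷ ys , zs , refl ∷ ys⊆ , _ ∷ʳ zs⊆ , p ∷ pys , qzs , cong ℕ.suc eq
⊆-split (inj₂ q ∷ ps) =
  let ys , zs , ys⊆ , zs⊆ , pys , qzs , eq = ⊆-split ps
  in ys , _ ∷ zs , _ ∷ʳ ys⊆ , refl ∷ zs⊆ , pys , q ∷ qzs ,
     trans (cong ℕ.suc eq) (sym (ℕ.+-suc (length ys) (length zs)))

-- The classes may overlap: an element is counted in the class that its proof names. Induction on
-- `k` splits off the class `zero`.
length≤classes*bound : ∀ {A : Set} {R : A → A → Set} {N} k (P : Fin k → A → Set) {xs} →
  (∀ d {ys} → All (P d) ys → AllPairs R ys → length ys ≤ℕ N) →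
  All (λ x → ∃[ d ] P d x) xs → AllPairs R xs → length xs ≤ℕ k ℕ.* N
length≤classes*bound ℕ.zero    P bound []             _ = ℕ.z≤n
length≤classes*bound ℕ.zero    P bound ((() , _) ∷ _) _
length≤classes*bound {N = N} (ℕ.suc k) P {xs} bound ps rs =
  let ys , zs , ys⊆ , zs⊆ , pys , pzs , eq = ⊆-split (All.map zero-or-suc ps) in begin
  length xs                    ≡⟨ eq ⟩
  length ys ℕ.+ length zs
    ≤⟨ ℕ.+-mono-≤ (bound zero pys (AllPairs-resp-⊆ ys⊆ rs))
         (length≤classes*bound k (P ∘ suc) (bound ∘ suc) pzs (AllPairs-resp-⊆ zs⊆ rs)) ⟩
  N ℕ.+ k ℕ.* N                ∎
  where
  open ℕ.≤-Reasoning
  zero-or-suc : ∀ {x} → ∃[ d ] P d x → P zero x ⊎ ∃[ d ] P (suc d) x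
  zero-or-suc (zero  , p) = inj₁ p
  zero-or-suc (suc d , p) = inj₂ (d , p)

x∉p-x : ∀ {n} (p : Subset n) x → x ∉ p - x
x∉p-x (_ ∷ᵛ p) zero    ()
x∉p-x (_ ∷ᵛ p) (suc x) (there x∈) = x∉p-x p x x∈

p-x⊆p : ∀ {n} {p : Subset n} {x} → p - x ⊆ p
p-x⊆p {p = p} = p─q⊆p p _

p⊆q⇒p-x⊆q-x : ∀ {n} {p q : Subset n} {x} → p ⊆ q → p - x ⊆ q - x
p⊆q⇒p-x⊆q-x {p = p} p⊆q y∈ =
  x∈p∧x≢y⇒x∈p-y (p⊆q (p-x⊆p y∈)) λ { refl → x∉p-x p _ y∈ }

-- The bound over an ordered monoid

module MinimalWeights
  (M : OrderedMonoid) {n k : ℕ} (G : WeightedColouredGraph n k)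
  (weight : Fin (WeightedColouredGraph.size G) → OrderedMonoid.Carrier M)
  (weight-nonneg : ∀ e → OrderedMonoid._⊑_ M (OrderedMonoid.ε M) (weight e))
  {u v : Fin n} (u≢v : u ≢ v)
  where

  open OrderedMonoid M
  open WeightedColouredGraph G using (size; source; target; colour)
  open Paths G using (IsWalk; last; step; Path; edges)

  Edges : Set
  Edges = List (Fin size)

  Weight : Set
  Weight = Fin k → Carrier

  -- The value `f` is read off the proof of `P x`, not off `x`, because the stem belongs to the
  -- candidate and not to the weight it carries. The double negation comes from `¬¬-total`.
  minimum : ∀ {A : Set} {P : A → Set} (f : ∀ {x} → P x → Carrier) {x xs} → All P (x ∷ xs) →
    ¬ ¬ (∃₂ λ y (p : P y) → All (λ z → ∃[ q ] f p ⊑ f {z} q) (x ∷ xs))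
  minimum f (p ∷ []) k = k (_ , p , (p , ⊑-refl) ∷ [])
  minimum f (p ∷ ps@(_ ∷ _)) k = minimum f ps λ where
    (y , q , q⊑) → ¬¬-total (f p) (f q) λ where
      (inj₁ p⊑q) → k (_ , p , (p , ⊑-refl) ∷
        All.map (λ { (r , q⊑r) → r , ⊑-trans p⊑q q⊑r }) q⊑)
      (inj₂ q⊑p) → k (y , q , (p , q⊑p) ∷ q⊑)

  -- Weights of lists of edges

  total : Edges → Carrier
  total es = foldr _∙_ ε (map weight es)

  total-++ : ∀ es fs → total (es ++ fs) ≈ total es ∙ total fs
  total-++ []       fs = ≈-sym (identityˡ (total fs))
  total-++ (e ∷ es) fs = ≈-trans (∙-congˡ (total-++ es fs))
    (≈-sym (assoc (weight e) (total es) (total fs)))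

  total-nonneg : ∀ es → ε ⊑ total es
  total-nonneg []       = ⊑-refl
  total-nonneg (e ∷ es) = begin
    ε                       ≈⟨ identityˡ ε ⟨
    ε ∙ ε                   ≤⟨ ∙-mono (weight-nonneg e) (total-nonneg es) ⟩
    weight e ∙ total es     ∎
    where open PosetReasoning poset

  _has-colour?_ : ∀ e c → Dec (colour e ≡ c)
  e has-colour? c = colour e ≟ c

  coloured : Fin k → Edges → Edges
  coloured c = filter (_has-colour? c)

  weightOf : Edges → Weight
  weightOf es c = total (coloured c es)

  weightOf-++ : ∀ es fs c → weightOf (es ++ fs) c ≈ weightOf es c ∙ weightOf fs c
  weightOf-++ es fs c = subst (λ gs → total gs ≈ weightOf es c ∙ weightOf fs c)
    (sym (filter-++ (_has-colour? c) es fs)) (total-++ (coloured c es) (coloured c fs))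

  weightOf-++-mono : ∀ es es′ fs fs′ {c} → weightOf es c ⊑ weightOf es′ c →
    weightOf fs c ⊑ weightOf fs′ c → weightOf (es ++ fs) c ⊑ weightOf (es′ ++ fs′) c
  weightOf-++-mono es es′ fs fs′ {c} es⊑ fs⊑ = begin
    weightOf (es ++ fs) c               ≈⟨ weightOf-++ es fs c ⟩
    weightOf es c ∙ weightOf fs c       ≤⟨ ∙-mono es⊑ fs⊑ ⟩
    weightOf es′ c ∙ weightOf fs′ c     ≈⟨ weightOf-++ es′ fs′ c ⟨
    weightOf (es′ ++ fs′) c             ∎
    where open PosetReasoning poset

  weightOf-tail : ∀ e es c → weightOf es c ⊑ weightOf (e ∷ es) c
  weightOf-tail e es c = begin
    weightOf es c                       ≈⟨ identityˡ (weightOf es c) ⟨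
    ε ∙ weightOf es c                   ≤⟨ ∙-mono (total-nonneg (coloured c (e ∷ []))) ⊑-refl ⟩
    weightOf (e ∷ []) c ∙ weightOf es c ≈⟨ weightOf-++ (e ∷ []) es c ⟨
    weightOf (e ∷ es) c                 ∎
    where open PosetReasoning poset

  weightOf-∷ʳ : ∀ es e c → c ≢ colour e → weightOf (es ++ e ∷ []) c ≈ weightOf es c
  weightOf-∷ʳ es e c c≢ = begin-equality
    weightOf (es ++ e ∷ []) c           ≈⟨ weightOf-++ es (e ∷ []) c ⟩
    weightOf es c ∙ weightOf (e ∷ []) c
      ≡⟨ cong (λ fs → weightOf es c ∙ total fs) (filter-reject (_has-colour? c) (≢-sym c≢)) ⟩
    weightOf es c ∙ ε                   ≈⟨ identityʳ (weightOf es c) ⟩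
    weightOf es c                       ∎
    where open PosetReasoning poset

  -- Routes inside a set of vertices

  -- A walk es from y to v inside R; it is simple because each hop leaves R
  -- without its source.
  data Route (R : Subset n) (y : Fin n) : Edges → Set where
    stop : y ≡ v → y ∈ R → Route R y []
    hop  : ∀ {e es} → source e ≡ y → y ∈ R → Route (R - y) (target e) es →
           Route R y (e ∷ es)

  Route-mono : ∀ {R R′ y es} → R ⊆ R′ → Route R y es → Route R′ y es
  Route-mono R⊆R′ (stop eq y∈R)  = stop eq (R⊆R′ y∈R)
  Route-mono R⊆R′ (hop eq y∈R r) = hop eq (R⊆R′ y∈R) (Route-mono (p⊆q⇒p-x⊆q-x R⊆R′) r)

  start∈ : ∀ {R y es} → Route R y es → y ∈ R
  start∈ (stop _ y∈R)  = y∈R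
  start∈ (hop _ y∈R _) = y∈R

  end∈ : ∀ {R y es} → Route R y es → v ∈ R
  end∈ (stop refl v∈R) = v∈R
  end∈ (hop _ _ r)     = p-x⊆p (end∈ r)

  vertices∈ : ∀ {R y es} → Route R y es → All (_∈ R) (y ∷ map target es)
  vertices∈ (stop _ y∈R)  = y∈R ∷ []
  vertices∈ (hop _ y∈R r) = y∈R ∷ All.map p-x⊆p (vertices∈ r)

  route-simple : ∀ {R y es} → Route R y es → Unique (y ∷ map target es)
  route-simple (stop _ _) = [] ∷ []
  route-simple {R} (hop _ _ r) =
    All.map (λ { x∈ refl → x∉p-x R _ x∈ }) (vertices∈ r) ∷ route-simple r

  route-isWalk : ∀ {R y e es} → Route R y (e ∷ es) → IsWalk y (e ∷ es) v
  route-isWalk (hop eq _ (stop eq′ _))  = last eq eq′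
  route-isWalk (hop eq _ r@(hop _ _ _)) = step eq (route-isWalk r)

  route⇒path : ∀ {R y es} → y ≢ v → Route R y es → ∃[ p ] edges {y} {v} p ≡ es
  route⇒path y≢v (stop y≡v _)  = contradiction y≡v y≢v
  route⇒path _   r@(hop _ _ _) =
    record { edges = _ ; isWalk = route-isWalk r ; simple = route-simple r } , refl

  walk⇒route : ∀ {R y w es} → w ≡ v → IsWalk y es w → Unique (y ∷ map target es) →
    All (_∈ R) (y ∷ map target es) → Route R y es
  walk⇒route w≡v (last eq eq′) ((y≢t ∷ []) ∷ _) (y∈R ∷ t∈R ∷ []) =
    hop eq y∈R (stop (trans eq′ w≡v) (x∈p∧x≢y⇒x∈p-y t∈R (≢-sym y≢t)))
  walk⇒route w≡v (step eq walk) (y≢ ∷ unique) (y∈R ∷ ∈R) = hop eq y∈R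
    (walk⇒route w≡v walk unique
      (All.zipWith (λ (y≢x , x∈R) → x∈p∧x≢y⇒x∈p-y x∈R (≢-sym y≢x)) (y≢ , ∈R)))

  -- If the route meets `z`, cutting off everything before `z` cannot raise any colour, as weights
  -- are nonnegative. Otherwise `z` can be deleted from the allowed vertices.
  avoid-or-suffix : ∀ {R y es} z → Route R y es → Route (R - z) y es ⊎
    ∃[ fs ] Route R z fs × (∀ c → weightOf fs c ⊑ weightOf es c)
  avoid-or-suffix {y = y} z r with y ≟ z
  avoid-or-suffix z r | yes refl = inj₂ (_ , r , λ _ → ⊑-refl)
  avoid-or-suffix z (stop eq y∈R) | no y≢z = inj₁ (stop eq (x∈p∧x≢y⇒x∈p-y y∈R y≢z))
  avoid-or-suffix {R} {y} z (hop {e} {es} eq y∈R r) | no y≢z with avoid-or-suffix z r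
  -- The recursion removes `y` before `z`, while `hop` expects `z` to be removed first.
  ... | inj₁ r′ = inj₁ (hop eq (x∈p∧x≢y⇒x∈p-y y∈R y≢z)
          (subst (λ S → Route S (target e) es) (p─x─y≡p─y─x R y z) r′))
  ... | inj₂ (fs , r′ , fs⊑) = inj₂ (fs , Route-mono p-x⊆p r′ ,
          λ c → ⊑-trans (fs⊑ c) (weightOf-tail e es c))

  -- Optimal weights, stems and candidates

  -- Minimality phrased without a strict order, so that it makes sense in an `OrderedMonoid`.
  Optimal : Weight → Set
  Optimal x = ∀ (q : Path u v) → (∀ c → weightOf (edges q) c ⊑ x c) →
    ∀ c → x c ⊑ weightOf (edges q) c

  -- R is the set of vertices not yet merged into u. A stem is a path from u
  -- through merged vertices to its tip, which extend expresses; stems of the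
  -- same class c have equal weights b except in the colour c, so that they are
  -- totally ordered.
  record Stem (R : Subset n) (c : Fin k) (b : Weight) : Set where
    field
      {tip}  : Fin n
      stem   : Edges
      extend : ∀ {es} → Route R tip es → Route ⊤ u (stem ++ es)
      agrees : ∀ d → d ≢ c → weightOf stem d ≈ b d

  -- `below` asks only for an inequality, which rerouting preserves, and `optimal` speaks of `x`
  -- alone, so it survives a change of route.
  record Candidate (R : Subset n) (c : Fin k) (b x : Weight) : Set where
    field
      start   : Stem R c b
      {rest}  : Edges
      route   : Route R (Stem.tip start) rest
      below   : ∀ d → weightOf (Stem.stem start ++ rest) d ⊑ x d
      optimal : Optimal x

  open Stem
  open Candidate using (start; rest; route; below; optimal)

  stem-⊑ : ∀ {R c b} (s t : Stem R c b) → weightOf (stem s) c ⊑ weightOf (stem t) c →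
    ∀ d → weightOf (stem s) d ⊑ weightOf (stem t) d
  stem-⊑ {c = c} {b} s t s⊑t d with d ≟ c
  ... | yes refl = s⊑t
  ... | no d≢c   = begin
    weightOf (stem s) d  ≈⟨ agrees s d d≢c ⟩
    b d                  ≈⟨ agrees t d d≢c ⟨
    weightOf (stem t) d  ∎
    where open PosetReasoning poset

  -- The first edge after `y` moves onto the stem and its colour names the new class. The new stem
  -- differs from `es` only in that colour, so `weightOf es` can serve as the common weight.
  advance : ∀ {R y es fs x} → (∀ {es′} → Route R y es′ → Route ⊤ u (es ++ es′)) →
    Route R y fs → y ≢ v → (∀ d → weightOf (es ++ fs) d ⊑ x d) → Optimal x →
    ∃[ d ] Candidate (R - y) d (weightOf es) x
  advance _ (stop y≡v _) y≢v _ _ = contradiction y≡v y≢v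
  advance {es = es} {x = x} ext (hop {e} {fs} eq y∈R r) _ es++fs⊑x opt = colour e , record
    { start = record
      { stem   = es ++ e ∷ []
      ; extend = λ r′ → subst (Route ⊤ u) (sym (++-assoc es (e ∷ []) _)) (ext (hop eq y∈R r′))
      ; agrees = weightOf-∷ʳ es e
      }
    ; route   = r
    ; below   = λ d → subst (λ gs → weightOf gs d ⊑ x d)
                        (sym (++-assoc es (e ∷ []) fs)) (es++fs⊑x d)
    ; optimal = opt
    }

  -- A candidate through the tip of s is rerouted to reach it along s, which by
  -- the choice of s costs no more; the others keep their stem and class.
  merge : ∀ {R c b x} (s : Stem R c b) → tip s ≢ v → (γ : Candidate R c b x) →
    weightOf (stem s) c ⊑ weightOf (stem (start γ)) c →
    ∃[ d ] Candidate (R - tip s) d (weightOf (stem s)) x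
  merge {c = c} s tip≢v γ s⊑γ with avoid-or-suffix (tip s) (route γ)
  ... | inj₁ r = c , record
    { start = record
      { stem   = stem (start γ)
      ; extend = extend (start γ) ∘ Route-mono p-x⊆p
      -- The common weight changes from `b` to that of `stem s`, which agrees with `b` outside `c`.
      ; agrees = λ d d≢c → ≈-trans (agrees (start γ) d d≢c) (≈-sym (agrees s d d≢c))
      }
    ; route   = r
    ; below   = below γ
    ; optimal = optimal γ
    }
  ... | inj₂ (fs , r , fs⊑) = advance (extend s) r tip≢v
    (λ d → ⊑-trans
      (weightOf-++-mono (stem s) (stem (start γ)) fs (rest γ)
        (stem-⊑ s (start γ) s⊑γ d) (fs⊑ d))
      (below γ d))
    (optimal γ)

  -- A cheapest stem ending in `v` is itself a path from `u` to `v` and lies below `x`, so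
  -- optimality forces equality. All candidates of the class thus carry one and the same weight.
  finished : ∀ {R c b x} (s : Stem R c b) → tip s ≡ v → (γ : Candidate R c b x) →
    weightOf (stem s) c ⊑ weightOf (stem (start γ)) c →
    ∀ d → x d ≈ weightOf (stem s ++ []) d
  finished {R} {x = x} s tip≡v γ s⊑γ with route⇒path u≢v
    (extend s (stop tip≡v (subst (_∈ R) (sym tip≡v) (end∈ (route γ)))))
  ... | p , refl = λ d → ⊑-antisym (optimal γ p s⊑x d) (s⊑x d)
    where
    s⊑x : ∀ d → weightOf (stem s ++ []) d ⊑ x d
    s⊑x d = ⊑-trans
      (weightOf-++-mono (stem s) (stem (start γ)) [] (rest γ)
        (stem-⊑ s (start γ) s⊑γ d) (total-nonneg (coloured d (rest γ))))
      (below γ d)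

  -- The counting induction

  Distinct : List Weight → Set
  Distinct = AllPairs (λ x y → ¬ (∀ c → x c ≈ y c))

  distinct-length≤1 : ∀ {a : Weight} {W} → All (λ x → ∀ c → x c ≈ a c) W →
    Distinct W → length W ≤ℕ 1
  distinct-length≤1 []       _ = ℕ.z≤n
  distinct-length≤1 (_ ∷ []) _ = ℕ.s≤s ℕ.z≤n
  distinct-length≤1 (x≈a ∷ y≈a ∷ _) ((x≉y ∷ _) ∷ _) =
    contradiction (λ c → ≈-trans (x≈a c) (≈-sym (y≈a c))) x≉y

  -- Every merge removes a vertex other than `v` from `R`, so at most `m` merges remain, and each
  -- one splits the class into at most `k` new ones.
  candidates-bound : ∀ m {R c b W} → card R ≤ℕ ℕ.suc m → All (Candidate R c b) W →
    Distinct W → length W ≤ℕ k ^ m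
  candidates-bound m {W = []} _ _ _ = ℕ.z≤n
  candidates-bound m {R} {c} {b} {W = W@(_ ∷ _)} |R|≤ γs distinct =
    decidable-stable (length W ℕ.≤? k ^ m) λ ≰ →
      minimum (λ γ → weightOf (stem (start γ)) c) γs λ (_ , γ , least) →
        ≰ (bound m |R|≤ γ least)
    where
    bound : ∀ m {x} → card R ≤ℕ ℕ.suc m → (γ : Candidate R c b x) →
      All (λ y → ∃[ δ ] weightOf (stem (start γ)) c ⊑
                        weightOf (stem (start {x = y} δ)) c) W →
      length W ≤ℕ k ^ m
    bound m |R|≤ γ least with tip (start γ) ≟ v
    bound m |R|≤ γ least | yes tip≡v = ℕ.≤-trans
      (distinct-length≤1
        (All.map (λ (δ , γ⊑δ) → finished (start γ) tip≡v δ γ⊑δ) least) distinct)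
      -- The colour `c` shows that `k` is nonzero, so a single weight fits under `k ^ m`.
      (ℕ.m^n>0 k {{nonZeroIndex c}} m)
    -- Here `R` has at most one element, yet it contains both the tip and `v`.
    bound ℕ.zero |R|≤ γ least | no tip≢v =
      contradiction (ℕ.≤-trans |R-tip|<|R| |R|≤) λ { (ℕ.s≤s |R-tip|≤0) →
        ℕ.n≮0 (ℕ.≤-trans (x∈p⇒∣p-x∣<∣p∣ v∈R-tip) |R-tip|≤0) }
      where
      |R-tip|<|R| = x∈p⇒∣p-x∣<∣p∣ (start∈ (route γ))
      v∈R-tip = x∈p∧x≢y⇒x∈p-y (end∈ (route γ)) (≢-sym tip≢v)
    bound (ℕ.suc m) |R|≤ γ least | no tip≢v =
      -- Merging replaces the candidates but not the weights they carry, so `distinct` still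
      -- applies.
      length≤classes*bound k
        (λ d → Candidate (R - tip (start γ)) d (weightOf (stem (start γ))))
        (λ d → candidates-bound m
          (ℕ.s≤s⁻¹ (ℕ.≤-trans (x∈p⇒∣p-x∣<∣p∣ (start∈ (route γ))) |R|≤)))
        (All.map (λ (δ , γ⊑δ) → merge (start γ) tip≢v δ γ⊑δ) least)
        distinct

  -- A path has at least one edge, which supplies a colour to name the initial class.
  first-colour : ∀ {y} → Path y v → Fin k
  first-colour p with edges p | Path.isWalk p
  ... | e ∷ _ | _ = colour e

  minimal-weights-bound : ∀ W →
    All (λ x → Optimal x × ∃[ p ] ∀ c → x c ≈ weightOf (edges {u} {v} p) c) W →
    Distinct W → length W ≤ℕ k ^ (n ∸ 1)
  minimal-weights-bound [] _ _ = ℕ.z≤n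
  minimal-weights-bound (_ ∷ _) ps@((_ , p , _) ∷ _) distinct =
    -- At first `R` is the whole vertex set, with `u` as the tip of the empty stem. The first merge
    -- removes `u` itself, so `n ∸ 1` merges leave only `v`.
    candidates-bound (n ∸ 1) (ℕ.≤-trans (ℕ.≤-reflexive (∣⊤∣≡n n)) (ℕ.m≤n+m∸n n 1))
      (All.map candidate ps) distinct
    where
    -- Empty stems agree in every colour, so any colour can be their class.
    candidate : ∀ {x} → Optimal x × ∃[ q ] (∀ c → x c ≈ weightOf (edges q) c) →
      Candidate ⊤ (first-colour p) (λ _ → ε) x
    candidate (opt , q , x≈q) = record
      { start   = record { stem = [] ; extend = id ; agrees = λ _ _ → ≈-refl }
      ; route   = walk⇒route refl (Path.isWalk q) (Path.simple q) (All.universal (λ _ → ∈⊤) _)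
      ; below   = λ c → ⊑-reflexive (≈-sym (x≈q c))
      ; optimal = opt
      }

-- The reals as an ordered monoid

p≤∣p∣ : ∀ p → p ℚ.≤ ∣ p ∣
p≤∣p∣ p with ℚ.≤-total 0ℚ p
... | inj₁ 0≤p = ℚ.≤-reflexive (sym (ℚ.0≤p⇒∣p∣≡p 0≤p))
... | inj₂ p≤0 = ℚ.≤-trans p≤0 (ℚ.0≤∣p∣ p)

p<p+q : ∀ p {q} → 0ℚ ℚ.< q → p ℚ.< p ℚ.+ q
p<p+q p {q} 0<q = subst (ℚ._< p ℚ.+ q) (ℚ.+-identityʳ p) (ℚ.+-monoʳ-< p 0<q)

q+[p-q]≡p : ∀ p q → q ℚ.+ (p ℚ.- q) ≡ p
q+[p-q]≡p = solve 2 (λ p q → q :+ (p :- q) := p) refl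
  where open +-*-Solver

∣p-q∣<ε⇒p<q+ε : ∀ p q {ε} → ∣ p ℚ.- q ∣ ℚ.< ε → p ℚ.< q ℚ.+ ε
∣p-q∣<ε⇒p<q+ε p q {ε} close = begin-strict
  p                   ≡⟨ q+[p-q]≡p p q ⟨
  q ℚ.+ (p ℚ.- q)     ≤⟨ ℚ.+-monoʳ-≤ q (p≤∣p∣ (p ℚ.- q)) ⟩
  q ℚ.+ ∣ p ℚ.- q ∣   <⟨ ℚ.+-monoʳ-< q close ⟩
  q ℚ.+ ε             ∎
  where open ℚ.≤-Reasoning

∣p-q∣≡∣q-p∣ : ∀ p q → ∣ p ℚ.- q ∣ ≡ ∣ q ℚ.- p ∣
∣p-q∣≡∣q-p∣ p q = trans (cong ∣_∣ (flip p q)) (ℚ.∣-p∣≡∣p∣ (q ℚ.- p))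
  where
  open +-*-Solver
  flip : ∀ p q → p ℚ.- q ≡ ℚ.- (q ℚ.- p)
  flip = solve 2 (λ p q → p :- q := :- (q :- p)) refl

p<q+ε⇒p-q<ε : ∀ p q {ε} → p ℚ.< q ℚ.+ ε → p ℚ.- q ℚ.< ε
p<q+ε⇒p-q<ε p q {ε} p<q+ε = begin-strict
  p ℚ.- q           <⟨ ℚ.+-monoˡ-< (ℚ.- q) p<q+ε ⟩
  q ℚ.+ ε ℚ.- q     ≡⟨ drop q ε ⟩
  ε                 ∎
  where
  open ℚ.≤-Reasoning
  drop : ∀ q ε → q ℚ.+ ε ℚ.- q ≡ ε
  drop = solve 2 (λ q ε → q :+ ε :- q := ε) refl
    where open +-*-Solver

∣p-q∣<ε : ∀ p q {ε} → p ℚ.< q ℚ.+ ε → q ℚ.< p ℚ.+ ε → ∣ p ℚ.- q ∣ ℚ.< ε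
∣p-q∣<ε p q {ε} p<q+ε q<p+ε with ℚ.∣p∣≡p∨∣p∣≡-p (p ℚ.- q)
... | inj₁ eq = subst (ℚ._< ε) (sym eq) (p<q+ε⇒p-q<ε p q p<q+ε)
... | inj₂ eq = subst (ℚ._< ε) (sym (trans eq (flip p q))) (p<q+ε⇒p-q<ε q p q<p+ε)
  where
  open +-*-Solver
  flip : ∀ p q → ℚ.- (p ℚ.- q) ≡ q ℚ.- p
  flip = solve 2 (λ p q → :- (p :- q) := q :- p) refl

-- Equivalent to _≤_; unlike the negation defining _≤_ it provides indices.
infix 4 _≲_

_≲_ : ℝ → ℝ → Set
x ≲ y = ∀ ε → 0ℚ ℚ.< ε → ∃[ N ] ∀ n → N ℕ.≤ n → seq x n ℚ.< seq y n ℚ.+ ε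

-- A gap of `ε` and closeness within the same `ε` clash at any index beyond both bounds.
≲⇒≤ : ∀ {x y} → x ≲ y → x ≤ y
≲⇒≤ x≲y (ε , 0<ε , N₁ , gap) with x≲y ε 0<ε
... | N₂ , close = ℚ.<-irrefl refl (ℚ.<-≤-trans
  (close (N₁ ℕ.⊔ N₂) (ℕ.m≤n⊔m N₁ N₂))
  (gap (N₁ ℕ.⊔ N₂) (ℕ.m≤m⊔n N₁ N₂)))

-- δ, ζ and η are ε/2, ε/4 and ε/8.
≤⇒≲-at : ∀ {x y} → x ≤ y → ∀ {ε δ ζ η} →
  δ ℚ.+ δ ≡ ε → ζ ℚ.+ ζ ≡ δ → η ℚ.+ η ≡ ζ → 0ℚ ℚ.< ζ → 0ℚ ℚ.< η →
  ∃[ N ] ∀ n → N ℕ.≤ n → seq x n ℚ.< seq y n ℚ.+ ε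
≤⇒≲-at {x} {y} x≤y {ε} {δ} {ζ} {η} 2δ≡ε 2ζ≡δ 2η≡ζ 0<ζ 0<η
  with cauchy x η 0<η | cauchy y η 0<η
... | N₁ , x-close | N₂ , y-close = N , λ n N≤n → begin-strict
  seq x n
    <⟨ x-near N≤n ℕ.≤-refl ⟩
  seq x N ℚ.+ η
    -- Comparison of rationals is decidable, so it suffices to refute a gap of `δ` at the index `N`.
    -- Two drifts of `η` would leave a lasting gap of `ζ`, that is, `y < x`.
    ≤⟨ ℚ.+-monoˡ-≤ η (ℚ.≮⇒≥ λ gap → x≤y (gap⇒y<x gap)) ⟩
  seq y N ℚ.+ δ ℚ.+ η
    <⟨ ℚ.+-monoˡ-< η (ℚ.+-monoˡ-< δ (y-near ℕ.≤-refl N≤n)) ⟩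
  seq y n ℚ.+ η ℚ.+ δ ℚ.+ η
    ≡⟨ regroup (seq y n) δ ⟩
  seq y n ℚ.+ (δ ℚ.+ ζ)
    <⟨ ℚ.+-monoʳ-< (seq y n) (ℚ.+-monoʳ-< δ (p<p+q ζ 0<ζ)) ⟩
  seq y n ℚ.+ (δ ℚ.+ (ζ ℚ.+ ζ))
    ≡⟨ cong (λ z → seq y n ℚ.+ (δ ℚ.+ z)) 2ζ≡δ ⟩
  seq y n ℚ.+ (δ ℚ.+ δ)
    ≡⟨ cong (seq y n ℚ.+_) 2δ≡ε ⟩
  seq y n ℚ.+ ε ∎
  where
  open ℚ.≤-Reasoning

  N : ℕ
  N = N₁ ℕ.⊔ N₂

  x-near : ∀ {m n} → N ℕ.≤ m → N ℕ.≤ n → seq x m ℚ.< seq x n ℚ.+ η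
  x-near {m} {n} N≤m N≤n = ∣p-q∣<ε⇒p<q+ε (seq x m) (seq x n)
    (x-close m n (ℕ.m⊔n≤o⇒m≤o N₁ N₂ N≤m) (ℕ.m⊔n≤o⇒m≤o N₁ N₂ N≤n))

  y-near : ∀ {m n} → N ℕ.≤ m → N ℕ.≤ n → seq y m ℚ.< seq y n ℚ.+ η
  y-near {m} {n} N≤m N≤n = ∣p-q∣<ε⇒p<q+ε (seq y m) (seq y n)
    (y-close m n (ℕ.m⊔n≤o⇒n≤o N₁ N₂ N≤m) (ℕ.m⊔n≤o⇒n≤o N₁ N₂ N≤n))

  regroup : ∀ a b → a ℚ.+ η ℚ.+ b ℚ.+ η ≡ a ℚ.+ (b ℚ.+ ζ)
  regroup a b = trans (collect a b η) (cong (λ z → a ℚ.+ (b ℚ.+ z)) 2η≡ζ)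
    where
    open +-*-Solver
    collect : ∀ a b c → a ℚ.+ c ℚ.+ b ℚ.+ c ≡ a ℚ.+ (b ℚ.+ (c ℚ.+ c))
    collect = solve 3 (λ a b c → a :+ c :+ b :+ c := a :+ (b :+ (c :+ c))) refl

  gap⇒y<x : seq y N ℚ.+ δ ℚ.< seq x N → y < x
  gap⇒y<x gap = ζ , 0<ζ , N , λ n N≤n →
    ℚ.≮⇒≥ λ xₙ<yₙ+ζ → ℚ.<-irrefl refl (begin-strict
      seq y N ℚ.+ δ
        <⟨ gap ⟩
      seq x N
        <⟨ x-near ℕ.≤-refl N≤n ⟩
      seq x n ℚ.+ η
        <⟨ ℚ.+-monoˡ-< η xₙ<yₙ+ζ ⟩
      seq y n ℚ.+ ζ ℚ.+ η
        <⟨ ℚ.+-monoˡ-< η (ℚ.+-monoˡ-< ζ (y-near N≤n ℕ.≤-refl)) ⟩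
      seq y N ℚ.+ η ℚ.+ ζ ℚ.+ η
        ≡⟨ regroup (seq y N) ζ ⟩
      seq y N ℚ.+ (ζ ℚ.+ ζ)
        ≡⟨ cong (seq y N ℚ.+_) 2ζ≡δ ⟩
      seq y N ℚ.+ δ ∎)

≤⇒≲ : ∀ {x y} → x ≤ y → x ≲ y
≤⇒≲ {x} {y} x≤y ε 0<ε = ≤⇒≲-at {x} {y} x≤y
  (halves ε) (halves (½ ℚ.* ε)) (halves (½ ℚ.* (½ ℚ.* ε)))
  (0<½* {½ ℚ.* ε} (0<½* {ε} 0<ε))
  (0<½* {½ ℚ.* (½ ℚ.* ε)} (0<½* {½ ℚ.* ε} (0<½* {ε} 0<ε)))

≲-trans : ∀ {x y z} → x ≲ y → y ≲ z → x ≲ z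
≲-trans {x} {y} {z} x≲y y≲z ε 0<ε
  with x≲y (½ ℚ.* ε) (0<½* 0<ε) | y≲z (½ ℚ.* ε) (0<½* 0<ε)
... | N₁ , close₁ | N₂ , close₂ = N₁ ℕ.⊔ N₂ , λ n N≤n → begin-strict
  seq x n
    <⟨ close₁ n (ℕ.m⊔n≤o⇒m≤o N₁ N₂ N≤n) ⟩
  seq y n ℚ.+ ½ ℚ.* ε
    <⟨ ℚ.+-monoˡ-< (½ ℚ.* ε) (close₂ n (ℕ.m⊔n≤o⇒n≤o N₁ N₂ N≤n)) ⟩
  seq z n ℚ.+ ½ ℚ.* ε ℚ.+ ½ ℚ.* ε
    ≡⟨ ℚ.+-assoc (seq z n) (½ ℚ.* ε) (½ ℚ.* ε) ⟩
  seq z n ℚ.+ (½ ℚ.* ε ℚ.+ ½ ℚ.* ε)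
    ≡⟨ cong (seq z n ℚ.+_) (halves ε) ⟩
  seq z n ℚ.+ ε ∎
  where open ℚ.≤-Reasoning

+-mono-≲ : ∀ {x y x′ y′} → x ≲ y → x′ ≲ y′ → x + x′ ≲ y + y′
+-mono-≲ {x} {y} {x′} {y′} x≲y x′≲y′ ε 0<ε
  with x≲y (½ ℚ.* ε) (0<½* 0<ε) | x′≲y′ (½ ℚ.* ε) (0<½* 0<ε)
... | N₁ , close₁ | N₂ , close₂ = N₁ ℕ.⊔ N₂ , λ n N≤n → begin-strict
  seq x n ℚ.+ seq x′ n
    <⟨ ℚ.+-mono-< (close₁ n (ℕ.m⊔n≤o⇒m≤o N₁ N₂ N≤n))
                  (close₂ n (ℕ.m⊔n≤o⇒n≤o N₁ N₂ N≤n)) ⟩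
  (seq y n ℚ.+ ½ ℚ.* ε) ℚ.+ (seq y′ n ℚ.+ ½ ℚ.* ε)
    ≡⟨ regroup (seq y n) (seq y′ n) (½ ℚ.* ε) ⟩
  seq y n ℚ.+ seq y′ n ℚ.+ (½ ℚ.* ε ℚ.+ ½ ℚ.* ε)
    ≡⟨ cong (seq y n ℚ.+ seq y′ n ℚ.+_) (halves ε) ⟩
  seq y n ℚ.+ seq y′ n ℚ.+ ε ∎
  where
  open ℚ.≤-Reasoning
  regroup : ∀ a b c → (a ℚ.+ c) ℚ.+ (b ℚ.+ c) ≡ a ℚ.+ b ℚ.+ (c ℚ.+ c)
  regroup = solve 3 (λ a b c → (a :+ c) :+ (b :+ c) := a :+ b :+ (c :+ c)) refl
    where open +-*-Solver

≤-trans : ∀ {x y z} → x ≤ y → y ≤ z → x ≤ z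
≤-trans {x} {y} {z} x≤y y≤z =
  ≲⇒≤ {x} {z} (≲-trans {x} {y} {z} (≤⇒≲ {x} {y} x≤y) (≤⇒≲ {y} {z} y≤z))

+-mono-≤ : ∀ {x y x′ y′} → x ≤ y → x′ ≤ y′ → x + x′ ≤ y + y′
+-mono-≤ {x} {y} {x′} {y′} x≤y x′≤y′ = ≲⇒≤ {x + x′} {y + y′}
  (+-mono-≲ {x} {y} {x′} {y′} (≤⇒≲ {x} {y} x≤y) (≤⇒≲ {x′} {y′} x′≤y′))

<⇒≤ : ∀ {x y} → x < y → x ≤ y
<⇒≤ {x} {y} (δ , 0<δ , N₁ , x+δ≤y) (ε , 0<ε , N₂ , y+ε≤x) = ℚ.<-irrefl refl
  (begin-strict
    seq x N               <⟨ p<p+q (seq x N) 0<δ ⟩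
    seq x N ℚ.+ δ         ≤⟨ x+δ≤y N (ℕ.m≤m⊔n N₁ N₂) ⟩
    seq y N               <⟨ p<p+q (seq y N) 0<ε ⟩
    seq y N ℚ.+ ε         ≤⟨ y+ε≤x N (ℕ.m≤n⊔m N₁ N₂) ⟩
    seq x N               ∎)
  where
  open ℚ.≤-Reasoning
  N = N₁ ℕ.⊔ N₂

-- Given `y < x`, the second alternative holds; so refuting both alternatives refutes `y < x`, which
-- is the first one.
≤-total : ∀ x y → ¬ ¬ (x ≤ y ⊎ y ≤ x)
≤-total x y neither = neither (inj₁ λ y<x → neither (inj₂ (<⇒≤ {y} {x} y<x)))

≃⇒≤ : ∀ {x y} → x ≃ y → x ≤ y
≃⇒≤ {x} {y} x≃y = ≲⇒≤ {x} {y} λ ε 0<ε → let N , close = x≃y ε 0<ε in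
  N , λ n N≤n → ∣p-q∣<ε⇒p<q+ε _ _ (close n N≤n)

≲-antisym : ∀ {x y} → x ≲ y → y ≲ x → x ≃ y
≲-antisym {x} {y} x≲y y≲x ε 0<ε with x≲y ε 0<ε | y≲x ε 0<ε
... | N₁ , close₁ | N₂ , close₂ = N₁ ℕ.⊔ N₂ , λ n N≤n →
  ∣p-q∣<ε (seq x n) (seq y n)
    (close₁ n (ℕ.m⊔n≤o⇒m≤o N₁ N₂ N≤n)) (close₂ n (ℕ.m⊔n≤o⇒n≤o N₁ N₂ N≤n))

≤-antisym : ∀ {x y} → x ≤ y → y ≤ x → x ≃ y
≤-antisym {x} {y} x≤y y≤x =
  ≲-antisym {x} {y} (≤⇒≲ {x} {y} x≤y) (≤⇒≲ {y} {x} y≤x)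

≃-sym : ∀ {x y} → x ≃ y → y ≃ x
≃-sym {x} {y} x≃y ε 0<ε = let N , close = x≃y ε 0<ε in N , λ n N≤n →
  subst (ℚ._< ε) (∣p-q∣≡∣q-p∣ (seq x n) (seq y n)) (close n N≤n)

-- Inherited from the order by antisymmetry, which avoids another estimate with `ε`.
≃-trans : ∀ {x y z} → x ≃ y → y ≃ z → x ≃ z
≃-trans {x} {y} {z} x≃y y≃z = ≤-antisym {x} {z}
  (≤-trans {x} {y} {z} (≃⇒≤ {x} {y} x≃y) (≃⇒≤ {y} {z} y≃z))
  (≤-trans {z} {y} {x} (≃⇒≤ {z} {y} (≃-sym {y} {z} y≃z))
                       (≃⇒≤ {y} {x} (≃-sym {x} {y} x≃y)))

≗⇒≃ : ∀ {x y} → (∀ n → seq x n ≡ seq y n) → x ≃ y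
≗⇒≃ {x} {y} x≗y ε 0<ε = 0 , λ n _ →
  subst (λ z → ∣ z ℚ.- seq y n ∣ ℚ.< ε) (sym (x≗y n))
    (subst (ℚ._< ε) (cong ∣_∣ (sym (ℚ.+-inverseʳ (seq y n)))) 0<ε)

≃-refl : ∀ {x} → x ≃ x
≃-refl {x} = ≗⇒≃ {x} {x} λ _ → refl

≃-isEquivalence : IsEquivalence _≃_
≃-isEquivalence = record
  { refl  = λ {x} → ≃-refl {x}
  ; sym   = λ {x y} → ≃-sym {x} {y}
  ; trans = λ {x y z} → ≃-trans {x} {y} {z}
  }

≤-isPartialOrder : IsPartialOrder _≃_ _≤_
≤-isPartialOrder = record
  { isPreorder = record
    { isEquivalence = ≃-isEquivalence
    ; reflexive     = λ {x y} → ≃⇒≤ {x} {y}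
    ; trans         = λ {x y z} → ≤-trans {x} {y} {z}
    }
  ; antisym    = λ {x y} → ≤-antisym {x} {y}
  }

+-cong : ∀ {x y x′ y′} → x ≃ y → x′ ≃ y′ → x + x′ ≃ y + y′
+-cong {x} {y} {x′} {y′} x≃y x′≃y′ = ≤-antisym {x + x′} {y + y′}
  (+-mono-≤ {x} {y} {x′} {y′} (≃⇒≤ {x} {y} x≃y) (≃⇒≤ {x′} {y′} x′≃y′))
  (+-mono-≤ {y} {x} {y′} {x′} (≃⇒≤ {y} {x} (≃-sym {x} {y} x≃y))
                              (≃⇒≤ {y′} {x′} (≃-sym {x′} {y′} x′≃y′)))

+-0-isMonoid : IsMonoid _≃_ _+_ 0ℝ
+-0-isMonoid = record
  { isSemigroup = record
    { isMagma = record
      { isEquivalence = ≃-isEquivalence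
      ; ∙-cong        = λ {x y x′ y′} → +-cong {x} {y} {x′} {y′}
      }
    ; assoc   = λ x y z → ≗⇒≃ {x + y + z} {x + (y + z)}
        λ n → ℚ.+-assoc (seq x n) (seq y n) (seq z n)
    }
  ; identity    = (λ x → ≗⇒≃ {0ℝ + x} {x} λ n → ℚ.+-identityˡ (seq x n))
                , (λ x → ≗⇒≃ {x + 0ℝ} {x} λ n → ℚ.+-identityʳ (seq x n))
  }

+-0-orderedMonoid : OrderedMonoid
+-0-orderedMonoid = record
  { isMonoid       = +-0-isMonoid
  ; isPartialOrder = ≤-isPartialOrder
  ; ∙-mono         = λ {x y x′ y′} → +-mono-≤ {x} {y} {x′} {y′}
  ; ¬¬-total       = ≤-total
  }

-- The bound for real weights

theorem2 : (n k : ℕ) → 2 ≤ℕ n → (G : WeightedColouredGraph n k) →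
    let open Paths G in
    (u v : Fin n) → u ≢ v →
    ((S : List (Path u v)) → All Minimal S → AllPairs Incomparable S →
    length S ≤ℕ k ^ (n ∸ 1))
    × ((W : List (Fin k → ℝ)) → All (IsMinimalWeight u v) W →
    AllPairs (λ x y → ¬ (x ≋ y)) W → length W ≤ℕ k ^ (n ∸ 1))
theorem2 n k _ G u v u≢v = paths , weights
  where
  open WeightedColouredGraph G
  open Paths G

  weight-nonneg : ∀ e → 0ℝ ≤ weight e
  weight-nonneg e = <⇒≤ {0ℝ} {weight e} (weight-pos e)

  open MinimalWeights +-0-orderedMonoid G weight weight-nonneg u≢v
    using (Optimal; minimal-weights-bound)

  -- As `_≤_` is the negation of `_<_`, the negative statement of minimality gives the required
  -- inequality directly.
  minimal⇒optimal : ∀ {x} (p : Path u v) → Minimal p → x ≋ pathWeight p → Optimal x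
  minimal⇒optimal {x} p minimal x≋p q q≤x c =
    ≤-trans {x c} {pathWeight p c} {pathWeight q c} (≃⇒≤ {x c} {pathWeight p c} (x≋p c))
      λ q<p → minimal (q , q≼p , c , q<p)
    where
    q≼p : q ≼ p
    q≼p d = ≤-trans {pathWeight q d} {x d} {pathWeight p d}
      (q≤x d) (≃⇒≤ {x d} {pathWeight p d} (x≋p d))

  optimal-weight : ∀ {x} → IsMinimalWeight u v x → Optimal x × ∃[ p ] x ≋ pathWeight p
  optimal-weight {x} (p , minimal , x≋p) = minimal⇒optimal {x} p minimal x≋p , p , x≋p

  weights : ∀ W → All (IsMinimalWeight u v) W → AllPairs (λ x y → ¬ (x ≋ y)) W →
    length W ≤ℕ k ^ (n ∸ 1)
  weights W ps distinct =
    minimal-weights-bound W (All.map (λ {x} → optimal-weight {x}) ps) distinct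

  minimal-weight : ∀ {p} → Minimal p → IsMinimalWeight u v (pathWeight p)
  minimal-weight {p} minimal = p , minimal , λ c → ≃-refl {pathWeight p c}

  -- Paths of equal weight are comparable; this reduces the bound on paths to the bound on weights.
  incomparable⇒≉ : ∀ {p q} → Incomparable p q → ¬ (pathWeight p ≋ pathWeight q)
  incomparable⇒≉ {p} {q} (p⋠q , _) p≋q =
    p⋠q λ c → ≃⇒≤ {pathWeight p c} {pathWeight q c} (p≋q c)

  paths : ∀ S → All Minimal S → AllPairs Incomparable S → length S ≤ℕ k ^ (n ∸ 1)
  paths S minimal incomparable = subst (_≤ℕ k ^ (n ∸ 1)) (length-map pathWeight S)
    (weights (map pathWeight S)
      (All.map⁺ (All.map (λ {p} → minimal-weight {p}) minimal))
      (AllPairs.map⁺ (AllPairs.map (λ {p q} → incomparable⇒≉ {p} {q}) incomparable)))
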